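{- For every graph $G$, $\operatorname{box}(G)\le 2\,MED(G)+2$.
   Context: A dominating edge set of $G$ is a set $D$ of edges such that every edge of $G$ not in $D$ shares an endpoint with some edge of $D$; $MED(G)$ is the minimum cardinality of a dominating edge set. The boxicity $\operatorname{box}(G)$ is the minimum $b$ such that $G$ is the intersection graph of axis-parallel boxes in $\mathbb{R}^b$ (products of $b$ closed intervals), one box per vertex. -}

module Defs where

open import Data.Nat as ℕ using (ℕ)
open import Data.Fin as Fin using (Fin)
open import Data.Rational as ℚ using (ℚ)
open import Data.List using (List; length)
open import Data.List.Membership.Propositional using (_∈_; _∉_)
open import Data.List.Relation.Unary.All using (All)
open import Data.List.Relation.Unary.Unique.Propositional using (Unique)
open import Data.Product using (_×_; _,_; ∃-syntax; Σ-syntax)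
open import Data.Sum using (_⊎_)
open import Function.Bundles using (_⇔_)
open import Level using (Level; 0ℓ)
open import Relation.Binary.Core using (Rel)
open import Relation.Binary.Definitions using (Decidable; Symmetric; Irreflexive)
open import Relation.Binary.PropositionalEquality using (_≡_; _≢_)
open import Relation.Nullary using (¬_)
open import Relation.Unary using (Pred)

private
  variable
    ℓ : Level

-- Real numbers as two-sided located Dedekind cuts of ℚ:
-- lower q means q < x, and upper q means x < q.
record ℝ : Set₁ where
  field
    lower upper     : Pred ℚ 0ℓ
    lower-inhabited : ∃[ q ] lower q
    upper-inhabited : ∃[ q ] upper q
    lower-closed    : ∀ {p q} → p ℚ.< q → lower q → lower p
    upper-closed    : ∀ {p q} → p ℚ.< q → upper p → upper q
    lower-open      : ∀ {p} → lower p → ∃[ q ] (p ℚ.< q × lower q)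
    upper-open      : ∀ {q} → upper q → ∃[ p ] (p ℚ.< q × upper p)
    disjoint        : ∀ q → ¬ (lower q × upper q)
    located         : ∀ {p q} → p ℚ.< q → lower p ⊎ upper q

infix 4 _≤ᴿ_

_≤ᴿ_ : Rel ℝ 0ℓ
x ≤ᴿ y = ∀ q → ℝ.lower x q → ℝ.lower y q

record Interval : Set₁ where
  field
    lo hi : ℝ
    lo≤hi : lo ≤ᴿ hi

Point : ℕ → Set₁
Point b = Fin b → ℝ

Box : ℕ → Set₁
Box b = Fin b → Interval

infix 4 _∈ᴮ_

_∈ᴮ_ : ∀ {b} → Point b → Box b → Set
x ∈ᴮ B = ∀ i → Interval.lo (B i) ≤ᴿ x i × x i ≤ᴿ Interval.hi (B i)

Intersect : ∀ {b} → Box b → Box b → Set₁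
Intersect {b} B C = Σ[ x ∈ Point b ] (x ∈ᴮ B × x ∈ᴮ C)

record Graph : Set₁ where
  infix 4 _~_
  field
    order    : ℕ
    _~_      : Rel (Fin order) 0ℓ
    _~?_     : Decidable _~_
    ~-sym    : Symmetric _~_
    ~-irrefl : Irreflexive _≡_ _~_

  Vertex : Set
  Vertex = Fin order

IsMinimum : Pred ℕ ℓ → ℕ → Set ℓ
IsMinimum P m = P m × (∀ k → P k → m ℕ.≤ k)

module _ (G : Graph) where
  open Graph G

  record BoxRepresentation (b : ℕ) : Set₁ where
    field
      box        : Vertex → Box b
      represents : ∀ u v → u ≢ v → (u ~ v ⇔ Intersect (box u) (box v))

  -- ℝ⁰ is a single point, so complete graphs have boxicity 0.
  IsBoxicity : ℕ → Set₁
  IsBoxicity = IsMinimum BoxRepresentation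

  -- An undirected edge {u , v} is the pair (u , v) with u < v, so that each
  -- edge is counted once.
  IsEdge : Pred (Vertex × Vertex) 0ℓ
  IsEdge (u , v) = u Fin.< v × u ~ v

  ShareEndpoint : Rel (Vertex × Vertex) 0ℓ
  ShareEndpoint (u , v) (x , y) = u ≡ x ⊎ u ≡ y ⊎ v ≡ x ⊎ v ≡ y

  -- Edge sets are duplicate-free lists of edges, with cardinality the length.
  record IsDominatingEdgeSet (D : List (Vertex × Vertex)) : Set where
    field
      edges     : All IsEdge D
      unique    : Unique D
      dominates : ∀ e → IsEdge e → e ∉ D → ∃[ f ] (f ∈ D × ShareEndpoint e f)

  IsMED : ℕ → Set
  IsMED = IsMinimum λ k → ∃[ D ] (IsDominatingEdgeSet D × length D ≡ k)

{-# OPTIONS --safe #-}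
-- The endpoints of a dominating edge set D form a vertex cover S with at most
-- 2|D| vertices.  A vertex cover S gives a representation with |S| + 1
-- coordinates: for each s ∈ S, one coordinate puts s at 0, its neighbours on
-- [0 , 1] and its non-neighbours at 1; one more coordinate puts the vertices
-- outside S at distinct points, and those in S on an interval containing all
-- of them.
module Submission where

open import Data.Nat using (ℕ; _+_; _*_; _≤_)
open import Defs

open import Data.Empty using (⊥-elim)
open import Data.Fin as Fin using (Fin; toℕ)
import Data.Fin.Properties as Fin
import Data.Integer.Base as ℤ
import Data.Integer.Properties as ℤ
open import Data.List using (List; length; lookup; map; _++_)
open import Data.List.Membership.Propositional using (_∈_)
open import Data.List.Membership.Propositional.Properties using (∈-map⁺; ∈-++⁺ˡ; ∈-++⁺ʳ)
open import Data.List.Properties using (length-++; length-map)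
open import Data.List.Relation.Unary.Any using (index)
open import Data.List.Relation.Unary.Any.Properties using (lookup-index)
open import Data.Nat using (_⊔_; z≤n; s≤s)
import Data.Nat.Coprimality as Coprimality
import Data.Nat.Properties as ℕ
open import Data.Product using (_×_; _,_; proj₁; proj₂; swap)
open import Data.Product.Properties using (≡-dec)
open import Data.Rational as ℚ using (ℚ; mkℚ)
import Data.Rational.Properties as ℚ
open import Data.Sum as Sum using (_⊎_; inj₁; inj₂)
open import Function.Base using (_∘_)
open import Function.Bundles using (_⇔_; mk⇔; Equivalence)
open import Relation.Binary.Definitions using (tri<; tri≈; tri>)
open import Relation.Binary.PropositionalEquality using (_≡_; _≢_; refl; sym; trans; cong; cong₂; subst)
open import Relation.Nullary using (yes; no)

-- Embedding the rationals and the naturals into the Dedekind reals.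

ℚ⇒ℝ : ℚ → ℝ
ℚ⇒ℝ x = record
  { lower           = ℚ._< x
  ; upper           = x ℚ.<_
  ; lower-inhabited = x ℚ.- ℚ.1ℚ , subst (x ℚ.- ℚ.1ℚ ℚ.<_) (ℚ.+-identityʳ x) (ℚ.+-monoʳ-< x (ℚ.negative⁻¹ (ℚ.- ℚ.1ℚ)))
  ; upper-inhabited = x ℚ.+ ℚ.1ℚ , subst (ℚ._< x ℚ.+ ℚ.1ℚ) (ℚ.+-identityʳ x) (ℚ.+-monoʳ-< x (ℚ.positive⁻¹ ℚ.1ℚ))
  ; lower-closed    = ℚ.<-trans
  ; upper-closed    = λ p<q x<p → ℚ.<-trans x<p p<q
  ; lower-open      = ℚ.<-dense
  ; upper-open      = λ x<q → let r , x<r , r<q = ℚ.<-dense x<q in r , r<q , x<r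
  ; disjoint        = λ _ (q<x , x<q) → ℚ.<-asym q<x x<q
  ; located         = located
  }
  where
  located : ∀ {p q} → p ℚ.< q → p ℚ.< x ⊎ x ℚ.< q
  located {p} p<q with p ℚ.<? x
  ... | yes p<x = inj₁ p<x
  ... | no  p≮x = inj₂ (ℚ.≤-<-trans (ℚ.≮⇒≥ p≮x) p<q)

ℚ⇒ℝ-mono-≤ : ∀ {x y} → x ℚ.≤ y → ℚ⇒ℝ x ≤ᴿ ℚ⇒ℝ y
ℚ⇒ℝ-mono-≤ x≤y _ q<x = ℚ.<-≤-trans q<x x≤y

-- If `y` were below `x`, then `y` would lie in the lower cut of `x`, hence in its own lower cut.
ℚ⇒ℝ-cancel-≤ : ∀ {x y} → ℚ⇒ℝ x ≤ᴿ ℚ⇒ℝ y → x ℚ.≤ y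
ℚ⇒ℝ-cancel-≤ x≤y = ℚ.≮⇒≥ λ y<x → ℚ.<-irrefl refl (x≤y _ y<x)

-- The fraction is given directly in lowest terms (the 0 encodes denominator 1), so comparisons
-- reduce to numerators times `ℤ.+ 1`.
ℕ⇒ℚ : ℕ → ℚ
ℕ⇒ℚ n = mkℚ (ℤ.+ n) 0 (Coprimality.sym (Coprimality.1-coprimeTo n))

ℕ⇒ℚ-mono-≤ : ∀ {m n} → m ≤ n → ℕ⇒ℚ m ℚ.≤ ℕ⇒ℚ n
ℕ⇒ℚ-mono-≤ m≤n = ℚ.*≤* (ℤ.*-monoʳ-≤-nonNeg (ℤ.+ 1) (ℤ.+≤+ m≤n))

ℕ⇒ℚ-cancel-≤ : ∀ {m n} → ℕ⇒ℚ m ℚ.≤ ℕ⇒ℚ n → m ≤ n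
ℕ⇒ℚ-cancel-≤ (ℚ.*≤* m≤n) = ℤ.drop‿+≤+ (ℤ.*-cancelʳ-≤-pos _ _ (ℤ.+ 1) m≤n)

ℕ⇒ℝ : ℕ → ℝ
ℕ⇒ℝ = ℚ⇒ℝ ∘ ℕ⇒ℚ

ℕ⇒ℝ-mono-≤ : ∀ {m n} → m ≤ n → ℕ⇒ℝ m ≤ᴿ ℕ⇒ℝ n
ℕ⇒ℝ-mono-≤ = ℚ⇒ℝ-mono-≤ ∘ ℕ⇒ℚ-mono-≤

ℕ⇒ℝ-cancel-≤ : ∀ {m n} → ℕ⇒ℝ m ≤ᴿ ℕ⇒ℝ n → m ≤ n
ℕ⇒ℝ-cancel-≤ = ℕ⇒ℚ-cancel-≤ ∘ ℚ⇒ℝ-cancel-≤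

≤ᴿ-trans : ∀ {x y z} → x ≤ᴿ y → y ≤ᴿ z → x ≤ᴿ z
≤ᴿ-trans x≤y y≤z q = y≤z q ∘ x≤y q

-- Boxes with natural endpoints.

record ℕInterval : Set where
  constructor interval
  field
    lo hi : ℕ
    lo≤hi : lo ≤ hi

open ℕInterval

Overlap : ℕInterval → ℕInterval → Set
Overlap I J = lo I ≤ hi J × lo J ≤ hi I

realBox : ∀ {b} → (Fin b → ℕInterval) → Box b
realBox I i = record
  { lo    = ℕ⇒ℝ (lo (I i))
  ; hi    = ℕ⇒ℝ (hi (I i))
  ; lo≤hi = ℕ⇒ℝ-mono-≤ (lo≤hi (I i))
  }

-- The coordinatewise maximum of the lower ends is a common point. Conversely, a common point lies
-- above each lower end and below each upper end, which gives both crosswise inequalities.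
overlap⇔intersect : ∀ {b} (I J : Fin b → ℕInterval) →
                    (∀ i → Overlap (I i) (J i)) ⇔ Intersect (realBox I) (realBox J)
overlap⇔intersect I J = mk⇔
  (λ o → (λ i → ℕ⇒ℝ (lo (I i) ⊔ lo (J i)))
       , (λ i → ℕ⇒ℝ-mono-≤ (ℕ.m≤m⊔n _ _) , ℕ⇒ℝ-mono-≤ (ℕ.⊔-lub (lo≤hi (I i)) (proj₂ (o i))))
       , (λ i → ℕ⇒ℝ-mono-≤ (ℕ.m≤n⊔m (lo (I i)) _) , ℕ⇒ℝ-mono-≤ (ℕ.⊔-lub (proj₁ (o i)) (lo≤hi (J i)))))
  (λ (x , x∈I , x∈J) i → cross (x i) (proj₁ (x∈I i)) (proj₂ (x∈J i)) , cross (x i) (proj₁ (x∈J i)) (proj₂ (x∈I i)))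
  where
  cross : ∀ {m n} x → ℕ⇒ℝ m ≤ᴿ x → x ≤ᴿ ℕ⇒ℝ n → m ≤ n
  cross {m} {n} x m≤x x≤n = ℕ⇒ℝ-cancel-≤ (≤ᴿ-trans {ℕ⇒ℝ m} {x} {ℕ⇒ℝ n} m≤x x≤n)

module _ (G : Graph) where
  open Graph G
  open import Data.List.Membership.DecPropositional (Fin._≟_ {order}) using (_∈?_)
  open import Data.List.Membership.DecPropositional (≡-dec (Fin._≟_ {order}) (Fin._≟_ {order})) using () renaming (_∈?_ to _∈ᴱ?_)

  -- A box representation from a vertex cover.

  IsVertexCover : List Vertex → Set
  IsVertexCover S = ∀ {u v} → u ~ v → u ∈ S ⊎ v ∈ S

  starInterval : Vertex → Vertex → ℕInterval
  starInterval s v with v Fin.≟ s | s ~? v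
  ... | yes _ | _     = interval 0 0 z≤n
  ... | no  _ | yes _ = interval 0 1 z≤n
  ... | no  _ | no  _ = interval 1 1 ℕ.≤-refl

  -- Among the three intervals only [0 , 0] and [1 , 1] are disjoint, so the cases to refute pair
  -- `s` with a non-neighbour.
  starInterval-overlap : ∀ s {u v} → u ~ v → Overlap (starInterval s u) (starInterval s v)
  starInterval-overlap s {u} {v} u~v with u Fin.≟ s | s ~? u | v Fin.≟ s | s ~? v
  ... | yes _    | _       | yes _    | _       = z≤n , z≤n
  ... | yes _    | _       | no _     | yes _   = z≤n , z≤n
  ... | yes refl | _       | no _     | no s≁v  = ⊥-elim (s≁v u~v)
  ... | no _     | yes _   | yes _    | _       = z≤n , z≤n
  ... | no _     | no s≁u  | yes refl | _       = ⊥-elim (s≁u (~-sym u~v))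
  ... | no _     | yes _   | no _     | yes _   = z≤n , z≤n
  ... | no _     | yes _   | no _     | no _    = z≤n , s≤s z≤n
  ... | no _     | no _    | no _     | yes _   = s≤s z≤n , z≤n
  ... | no _     | no _    | no _     | no _    = s≤s z≤n , s≤s z≤n

  overlap-starInterval : ∀ {s v} → s ≢ v → Overlap (starInterval s s) (starInterval s v) → s ~ v
  overlap-starInterval {s} {v} s≢v o with s Fin.≟ s | v Fin.≟ s | s ~? v
  ... | _      | _       | yes s~v = s~v
  ... | no s≢s | _       | no _    = ⊥-elim (s≢s refl)
  ... | yes _  | yes v≡s | no _    = ⊥-elim (s≢v (sym v≡s))
  -- Here `s` sits at 0 and `v` at 1, so this component would say 1 ≤ 0.
  ... | yes _  | no _    | no _    with () ← proj₂ o

  module _ (S : List Vertex) (cover : IsVertexCover S) where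

    separatingInterval : Vertex → ℕInterval
    separatingInterval v with v ∈? S
    ... | yes _ = interval 0 order z≤n
    ... | no  _ = interval (toℕ v) (toℕ v) ℕ.≤-refl

    -- Distinct points arise only for two vertices outside `S`, and `cover` forbids an edge between
    -- those.
    separatingInterval-overlap : ∀ {u v} → u ~ v → Overlap (separatingInterval u) (separatingInterval v)
    separatingInterval-overlap {u} {v} u~v with u ∈? S | v ∈? S
    ... | yes _   | yes _   = z≤n , z≤n
    ... | yes _   | no _    = z≤n , Fin.toℕ≤n v
    ... | no _    | yes _   = Fin.toℕ≤n u , z≤n
    ... | no u∉S  | no v∉S  = ⊥-elim (Sum.[ u∉S , v∉S ] (cover u~v))

    overlap-separatingInterval : ∀ {u v} → u ≢ v → Overlap (separatingInterval u) (separatingInterval v) → u ∈ S ⊎ v ∈ S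
    overlap-separatingInterval {u} {v} u≢v o with u ∈? S | v ∈? S
    ... | yes u∈S | _       = inj₁ u∈S
    ... | no _    | yes v∈S = inj₂ v∈S
    ... | no _    | no _    = ⊥-elim (u≢v (Fin.toℕ-injective (ℕ.≤-antisym (proj₁ o) (proj₂ o))))

    -- Star coordinates are indexed by positions in `S`; a vertex listed twice just repeats its
    -- coordinate.
    coverInterval : Vertex → Fin (1 + length S) → ℕInterval
    coverInterval v Fin.zero    = separatingInterval v
    coverInterval v (Fin.suc k) = starInterval (lookup S k) v

    coverInterval-overlap : ∀ {u v} → u ~ v → ∀ i → Overlap (coverInterval u i) (coverInterval v i)
    coverInterval-overlap u~v Fin.zero    = separatingInterval-overlap u~v
    coverInterval-overlap u~v (Fin.suc k) = starInterval-overlap (lookup S k) u~v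

    overlap-at-member : ∀ {u v} → u ∈ S → u ≢ v → (∀ i → Overlap (coverInterval u i) (coverInterval v i)) → u ~ v
    overlap-at-member {u} {v} u∈S u≢v o = overlap-starInterval u≢v
      -- The entry of `S` at position `index u∈S` is `u`, so this coordinate is the star of `u`
      -- itself.
      (subst (λ s → Overlap (starInterval s u) (starInterval s v)) (sym (lookup-index u∈S)) (o (Fin.suc (index u∈S))))

    -- The separating coordinate forces one of the two vertices into `S`; the star coordinate of
    -- that vertex then decides adjacency.
    overlap-coverInterval : ∀ {u v} → u ≢ v → (∀ i → Overlap (coverInterval u i) (coverInterval v i)) → u ~ v
    overlap-coverInterval u≢v o with overlap-separatingInterval u≢v (o Fin.zero)
    ... | inj₁ u∈S = overlap-at-member u∈S u≢v o
    ... | inj₂ v∈S = ~-sym (overlap-at-member v∈S (u≢v ∘ sym) (swap ∘ o))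

    vertexCover⇒boxRepresentation : BoxRepresentation G (1 + length S)
    vertexCover⇒boxRepresentation = record
      { box        = realBox ∘ coverInterval
      ; represents = λ u v u≢v → let open Equivalence (overlap⇔intersect (coverInterval u) (coverInterval v)) in
          mk⇔ (to ∘ coverInterval-overlap) (overlap-coverInterval u≢v ∘ from)
      }

  -- From dominating edge sets to vertex covers.

  endpoints : List (Vertex × Vertex) → List Vertex
  endpoints D = map proj₁ D ++ map proj₂ D

  length-endpoints : ∀ D → length (endpoints D) ≡ length D + length D
  length-endpoints D = trans (length-++ (map proj₁ D)) (cong₂ _+_ (length-map proj₁ D) (length-map proj₂ D))

  ∈-endpoints₁ : ∀ {e D} → e ∈ D → proj₁ e ∈ endpoints D
  ∈-endpoints₁ e∈D = ∈-++⁺ˡ (∈-map⁺ proj₁ e∈D)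

  ∈-endpoints₂ : ∀ {e D} → e ∈ D → proj₂ e ∈ endpoints D
  ∈-endpoints₂ {D = D} e∈D = ∈-++⁺ʳ (map proj₁ D) (∈-map⁺ proj₂ e∈D)

  sharedEndpoint : ∀ {D x y f} → f ∈ D → ShareEndpoint G (x , y) f → x ∈ endpoints D ⊎ y ∈ endpoints D
  sharedEndpoint f∈D (inj₁ refl)               = inj₁ (∈-endpoints₁ f∈D)
  sharedEndpoint f∈D (inj₂ (inj₁ refl))        = inj₁ (∈-endpoints₂ f∈D)
  sharedEndpoint f∈D (inj₂ (inj₂ (inj₁ refl))) = inj₂ (∈-endpoints₁ f∈D)
  sharedEndpoint f∈D (inj₂ (inj₂ (inj₂ refl))) = inj₂ (∈-endpoints₂ f∈D)

  -- An edge in `D` contributes its own endpoints; any other edge shares one with an edge of `D`.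
  edge-covered : ∀ {D x y} → IsDominatingEdgeSet G D → IsEdge G (x , y) → x ∈ endpoints D ⊎ y ∈ endpoints D
  edge-covered {D} {x} {y} dom e with (x , y) ∈ᴱ? D
  ... | yes e∈D = inj₁ (∈-endpoints₁ e∈D)
  ... | no  e∉D = let _ , f∈D , share = IsDominatingEdgeSet.dominates dom _ e e∉D in sharedEndpoint f∈D share

  dominating⇒vertexCover : ∀ {D} → IsDominatingEdgeSet G D → IsVertexCover (endpoints D)
  dominating⇒vertexCover {D} dom {u} {v} u~v with Fin.<-cmp u v
  ... | tri≈ _ u≡v _ = ⊥-elim (~-irrefl u≡v u~v)
  -- Edges are stored with the smaller vertex first, so the pair is reversed and the answer swapped
  -- back.
  ... | tri> _ _ v<u = Sum.swap (edge-covered dom (v<u , ~-sym u~v))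
  ... | tri< u<v _ _ = edge-covered dom (u<v , u~v)

theorem16 : (G : Graph) (b m : ℕ) → IsBoxicity G b → IsMED G m → b ≤ 2 * m + 2
theorem16 G b m (_ , b-min) ((D , dom , refl) , _) = begin
  b                          ≤⟨ b-min _ (vertexCover⇒boxRepresentation G (endpoints G D) (dominating⇒vertexCover G dom)) ⟩
  1 + length (endpoints G D) ≡⟨ cong (1 +_) (length-endpoints G D) ⟩
  1 + (m + m)                ≡⟨ cong (λ k → 1 + (m + k)) (ℕ.+-identityʳ m) ⟨
  -- The construction uses `1 + 2 * m` coordinates, one fewer than the stated bound.
  1 + 2 * m                  ≤⟨ ℕ.n≤1+n _ ⟩
  2 + 2 * m                  ≡⟨ ℕ.+-comm 2 (2 * m) ⟩
  2 * m + 2                  ∎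
  where open ℕ.≤-Reasoning
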